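{- For every graph $G$ with circumference $k$ and girth at least $5$, and for every vertex $v$ of $G$, there is a $2$-colouring of $G$ with clustering $(4k^2)^{k^2}$ such that $v$ is properly coloured.
   Context: Graphs are finite, simple and undirected. The circumference of a graph that is not a forest is the length of its longest cycle; the circumference of a forest is $2$. The girth of a graph is the length of its shortest cycle (infinite for a forest). A $2$-colouring assigns one of at most two colours to each vertex (not necessarily properly). A monochromatic component is a connected component of the subgraph induced by all vertices of a single colour. A colouring has clustering $c$ if every monochromatic component has at most $c$ vertices. In a coloured graph $G$, a vertex $v$ is properly coloured if the colour of $v$ differs from the colour of $w$ for each edge $vw\in E(G)$. -}

module Defs where

open import Data.Fin.Base using (Fin)
open import Data.Fin.Properties using (_≟_)
open import Data.Fin.Subset using (Subset; Nonempty; _∈_; _⊆_; ∣_∣)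
open import Data.List.Base using (List; _∷_; _∷ʳ_; length)
open import Data.List.Relation.Unary.Linked using (Linked)
open import Data.List.Relation.Unary.Unique.Propositional using (Unique)
open import Data.Nat.Base using (ℕ; _≤_)
open import Data.Product.Base using (_×_; ∃-syntax)
open import Data.Sum.Base using (_⊎_)
open import Data.Vec.Base using (tabulate)
open import Level using (0ℓ)
open import Relation.Binary.Construct.Add.Supremum.NonStrict _≤_ public using (_≤⁺_)
open import Relation.Binary.Construct.Closure.ReflexiveTransitive using (Star)
open import Relation.Binary.Core using (Rel)
open import Relation.Binary.Definitions using (Decidable; Irreflexive; Symmetric)
open import Relation.Binary.PropositionalEquality.Core using (_≡_; _≢_)
open import Relation.Nullary.Construct.Add.Supremum public using (_⁺; ⊤⁺; [_])
open import Relation.Nullary.Decidable.Core using (⌊_⌋)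
open import Relation.Nullary.Negation.Core using (¬_)

record Graph (n : ℕ) : Set₁ where
  infix 4 _~_ _~?_
  field
    _~_      : Rel (Fin n) 0ℓ
    ~-sym    : Symmetric _~_
    ~-irrefl : Irreflexive _≡_ _~_
    _~?_     : Decidable _~_

module _ {n : ℕ} (G : Graph n) where
  open Graph G

  -- A cycle is given by its vertices in cyclic order, each listed once;
  -- appending the first vertex at the end supplies the closing edge.
  record Cycle : Set where
    field
      first    : Fin n
      rest     : List (Fin n)
      distinct : Unique (first ∷ rest)
      edges    : Linked _~_ (first ∷ rest ∷ʳ first)
      long     : 3 ≤ length (first ∷ rest)

  cycleLength : Cycle → ℕ
  cycleLength C = length (Cycle.first C ∷ Cycle.rest C)

  IsForest : Set
  IsForest = ¬ Cycle

  IsCircumference : ℕ → Set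
  IsCircumference k =
    (IsForest × k ≡ 2) ⊎
    ((∃[ C ] cycleLength C ≡ k) × (∀ C → cycleLength C ≤ k))

  -- Girth takes values in ℕ extended by a top element ⊤⁺ (infinity).
  IsGirth : ℕ ⁺ → Set
  IsGirth ⊤⁺    = IsForest
  IsGirth [ g ] = (∃[ C ] cycleLength C ≡ g) × (∀ C → g ≤ cycleLength C)

  InducedAdj : Subset n → Rel (Fin n) 0ℓ
  InducedAdj S u w = u ∈ S × w ∈ S × u ~ w

  IsConnected : Subset n → Set
  IsConnected S = Nonempty S × (∀ {u w} → u ∈ S → w ∈ S → Star (InducedAdj S) u w)

  -- C is the vertex set of a connected component of the subgraph induced by S,
  -- i.e. inclusion-maximal among the connected subsets of S.
  IsComponent : Subset n → Subset n → Set
  IsComponent S C =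
    C ⊆ S × IsConnected C ×
    (∀ D → D ⊆ S → IsConnected D → C ⊆ D → D ⊆ C)

  Colouring : ℕ → Set
  Colouring q = Fin n → Fin q

  module _ {q : ℕ} (f : Colouring q) where

    colourClass : Fin q → Subset n
    colourClass i = tabulate λ v → ⌊ f v ≟ i ⌋

    HasClustering : ℕ → Set
    HasClustering c = ∀ i C → IsComponent (colourClass i) C → ∣ C ∣ ≤ c

    ProperlyColoured : Fin n → Set
    ProperlyColoured v = ∀ w → v ~ w → f v ≢ f w

-- Take a normal spanning forest (a depth-first search forest) of G with v as a root,
-- so that every edge joins a vertex to one of its ancestors, and colour each vertex
-- differently from its highest neighbour.  If u has the colour of a neighbour y above
-- it, then u also has a neighbour x above y.  Hence v is properly coloured, and each
-- proper subtree q that a monochromatic component reaches from above has an edge to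
-- a strict ancestor of the parent of q.
--
-- Such edges behave like 2-connectivity.  They span fewer than k levels because they
-- close cycles with the forest, and chaining them upwards gives ever longer cycles, so
-- a component has depth less than k² below its top t.  At each z below t, each child
-- whose subtree meets the component contains a common neighbour u of two of the k
-- nearest ancestors x, y of z; since G has no 4-cycle, (x , y) determines that child.
-- So the relevant part of the forest has branching at most k² and depth less than k².
module Submission where

open import Defs
open import Data.Empty using (⊥)
open import Data.Fin.Base as Fin using (Fin; zero; suc; opposite)
open import Data.Fin.Properties using (_≟_; any?; pigeonhole)
open import Data.Fin.Subset as Subset using (Subset; ∣_∣; ⁅_⁆; _∪_; inside; outside)
open import Data.Fin.Subset.Properties as Subsetₚ using (_∈?_; p⊆q⇒∣p∣≤∣q∣)
open import Data.List.Base
  using (List; []; _∷_; _++_; _∷ʳ_; length; lookup; reverse; foldr; map; cartesianProduct)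
import Data.List.Membership.DecPropositional as DecMembership
open import Data.List.Membership.Propositional using (_∈_)
open import Data.List.Membership.Propositional.Properties
  using (∈-lookup; ∈-++⁺ˡ; ∈-++⁺ʳ; ∈-cartesianProduct⁺)
open import Data.List.Properties using (length-++; length-map; length-reverse; unfold-reverse)
open import Data.List.Relation.Unary.All as All using (All; []; _∷_)
import Data.List.Relation.Unary.All.Properties as Allₚ
open import Data.List.Relation.Unary.AllPairs using ([]; _∷_)
open import Data.List.Relation.Unary.Any using (here; there)
import Data.List.Relation.Unary.Any.Properties as Anyₚ
open import Data.List.Relation.Unary.Linked using (Linked; [-]; _∷_)
open import Data.List.Relation.Unary.Unique.Propositional using (Unique)
import Data.List.Relation.Unary.Unique.Propositional.Properties as Uniqueₚ
open import Data.Maybe.Base using (Maybe; just; nothing)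
open import Data.Maybe.Properties using () renaming (≡-dec to maybe-≡-dec)
open import Data.Nat.Base
open import Data.Nat.Properties hiding (_≟_)
open import Data.Product.Base using (_×_; _,_; proj₁; proj₂; ∃; ∃-syntax; Σ-syntax; map₂)
open import Data.Sum.Base using (inj₁; inj₂)
open import Data.Vec.Base using ([]; _∷_)
open import Data.Vec.Properties using ([]=⇒lookup; lookup∘tabulate)
open import Function.Base using (_∘_; _$_; case_of_)
open import Relation.Binary.Construct.Add.Supremum.NonStrict using ([≤]-injective)
open import Relation.Binary.Construct.Closure.ReflexiveTransitive using (Star; ε; _◅_)
open import Relation.Binary.PropositionalEquality hiding ([_])
open import Relation.Nullary
open import Relation.Nullary.Decidable.Core using (isYes)

private variable
  n : ℕ

-- Finite combinatorics: minima, sums, lists and covers.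

module _ {P : Fin n → Set} (P? : ∀ x → Dec (P x)) (key : Fin n → ℕ) where

  Minimal : Fin n → Set
  Minimal x = P x × ∀ {y} → P y → key x ≤ key y

  minimal : ∃ P → ∃ Minimal
  minimal (x , px) = search (key x) x ≤-refl px
    where
    search : ∀ m x → key x ≤ m → P x → ∃ Minimal
    search m x x≤m px with any? (λ y → P? y ×-dec (key y <? key x))
    ... | no none = x , px , λ py → ≮⇒≥ λ y<x → none (_ , py , y<x)
    search zero x x≤m px | yes (y , py , y<x) = contradiction (<-≤-trans y<x x≤m) n≮0
    search (suc m) x x≤m px | yes (y , py , y<x) =
      search m y (s≤s⁻¹ (<-≤-trans y<x x≤m)) py

∑ : (Fin n → ℕ) → ℕ
∑ {zero}  f = 0
∑ {suc n} f = f zero + ∑ (f ∘ suc)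

∑-mono-≤ : {f g : Fin n → ℕ} → (∀ i → f i ≤ g i) → ∑ f ≤ ∑ g
∑-mono-≤ {zero}  f≤g = z≤n
∑-mono-≤ {suc n} f≤g = +-mono-≤ (f≤g zero) (∑-mono-≤ (f≤g ∘ suc))

∑-mono-< : {f g : Fin n → ℕ} → (∀ i → f i ≤ g i) → ∀ i → f i < g i → ∑ f < ∑ g
∑-mono-< f≤g zero    fi<gi = +-mono-<-≤ fi<gi (∑-mono-≤ (f≤g ∘ suc))
∑-mono-< f≤g (suc i) fi<gi = +-mono-≤-< (f≤g zero) (∑-mono-< (f≤g ∘ suc) i fi<gi)

∑-bound : {f : Fin n → ℕ} {b : ℕ} → (∀ i → f i ≤ b) → ∑ f ≤ n * b
∑-bound {zero}  f≤b = z≤n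
∑-bound {suc n} f≤b = +-mono-≤ (f≤b zero) (∑-bound (f≤b ∘ suc))

unique-lookup-≢ : ∀ {A : Set} {xs : List A} → Unique xs →
                  ∀ {i j} → i Fin.< j → lookup xs i ≢ lookup xs j
unique-lookup-≢ {xs = x ∷ xs} (x∉ ∷ _) {zero}  {suc j} _ = All.lookup x∉ (∈-lookup j)
unique-lookup-≢ {xs = x ∷ xs} (_ ∷ u) {suc i} {suc j} (s≤s i<j) = unique-lookup-≢ u i<j

unique-length : {xs : List (Fin n)} → Unique xs → length xs ≤ n
unique-length {n} {xs} u with length xs ≤? n
... | yes p = p
... | no ¬p with i , j , i<j , eq ← pigeonhole (≰⇒> ¬p) (lookup xs) =
  contradiction eq (unique-lookup-≢ u i<j)

unique-reverse : ∀ {A : Set} (xs : List A) → Unique xs → Unique (reverse xs)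
unique-reverse []       [] = []
unique-reverse (x ∷ xs) (x∉ ∷ u) rewrite unfold-reverse x xs =
  Uniqueₚ.++⁺ (unique-reverse xs u) ([] ∷ [])
    λ { (x∈ , here refl) → All.lookup x∉ (Anyₚ.reverse⁻ x∈) refl }

length-cartesianProduct : ∀ {A B : Set} (xs : List A) (ys : List B) →
                          length (cartesianProduct xs ys) ≡ length xs * length ys
length-cartesianProduct [] ys = refl
length-cartesianProduct (x ∷ xs) ys = trans (length-++ (map (x ,_) ys))
  (cong₂ _+_ (length-map (x ,_) ys) (length-cartesianProduct xs ys))

-- A size bound for a predicate by a list that may contain repetitions and non-members, so that
-- unions are concatenations and `P` need not be decidable.
Covered : {A : Set} → (A → Set) → ℕ → Set
Covered {A} P m = ∃[ L ] length {A = A} L ≤ m × (∀ {x} → P x → x ∈ L)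

module _ {A B : Set} {Q : B → A → Set} {m : ℕ} (cover : ∀ b → Covered (Q b) m) where

  covered-⋃ : ∀ (K : List B) → Covered (λ x → ∃[ b ] b ∈ K × Q b x) (length K * m)
  covered-⋃ [] = [] , z≤n , λ { (_ , () , _) }
  covered-⋃ (b ∷ K) with L , L≤ , L-covers ← cover b | M , M≤ , M-covers ← covered-⋃ K =
    L ++ M , subst (_≤ m + length K * m) (sym (length-++ L)) (+-mono-≤ L≤ M≤) , λ where
      (_ , here refl , q) → ∈-++⁺ˡ (L-covers q)
      (c , there c∈K , q) → ∈-++⁺ʳ L (M-covers (c , c∈K , q))

covered-size : ∀ {C : Subset n} {m} → Covered (Subset._∈ C) m → ∣ C ∣ ≤ m
covered-size {n} {C} (L , L≤m , covers) =
  ≤-trans (p⊆q⇒∣p∣≤∣q∣ (λ x∈C → ⊆-support L (covers x∈C))) (≤-trans (∣support∣ L) L≤m)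
  where
  support : List (Fin n) → Subset n
  support = foldr (λ x S → ⁅ x ⁆ ∪ S) Subset.⊥

  ⊆-support : ∀ L {x} → x ∈ L → x Subset.∈ support L
  ⊆-support (x ∷ L) (here refl) = Subsetₚ.x∈p∪q⁺ (inj₁ (Subsetₚ.x∈⁅x⁆ x))
  ⊆-support (y ∷ L) (there x∈L) = Subsetₚ.x∈p∪q⁺ (inj₂ (⊆-support L x∈L))

  ∣∪∣ : ∀ {n} (p q : Subset n) → ∣ p ∪ q ∣ ≤ ∣ p ∣ + ∣ q ∣
  ∣∪∣ [] [] = z≤n
  ∣∪∣ (outside ∷ p) (outside ∷ q) = ∣∪∣ p q
  ∣∪∣ (outside ∷ p) (inside ∷ q)  = ≤-trans (s≤s (∣∪∣ p q)) (≤-reflexive (sym (+-suc ∣ p ∣ ∣ q ∣)))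
  ∣∪∣ (inside ∷ p)  (outside ∷ q) = s≤s (∣∪∣ p q)
  ∣∪∣ (inside ∷ p)  (inside ∷ q)  =
    s≤s (≤-trans (∣∪∣ p q) (+-monoʳ-≤ ∣ p ∣ (n≤1+n ∣ q ∣)))

  ∣support∣ : ∀ L → ∣ support L ∣ ≤ length L
  ∣support∣ []      = ≤-reflexive (Subsetₚ.∣⊥∣≡0 n)
  ∣support∣ (x ∷ L) = ≤-trans (∣∪∣ ⁅ x ⁆ (support L))
    (+-mono-≤ (≤-reflexive (Subsetₚ.∣⁅x⁆∣≡1 x)) (∣support∣ L))

-- Walks, paths and cycles.

module Walks {n} (G : Graph n) where
  open Graph G

  infixr 5 _∷_

  ~⇒≢ : ∀ {x y} → x ~ y → x ≢ y
  ~⇒≢ e refl = ~-irrefl refl e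

  -- The list of vertices is an index, so that distinctness and membership are plain list
  -- predicates; lengths count vertices, not edges.
  data Walk : Fin n → Fin n → List (Fin n) → Set where
    ⟨_⟩ : ∀ x → Walk x x (x ∷ [])
    _∷_ : ∀ {x y z L} → x ~ y → Walk y z L → Walk x z (x ∷ L)

  _++ʷ_via_ : ∀ {x y z w L M} → Walk x y L → Walk z w M → y ~ z → Walk x w (L ++ M)
  ⟨ x ⟩   ++ʷ W via e = e ∷ W
  (d ∷ V) ++ʷ W via e = d ∷ (V ++ʷ W via e)

  reverseʷ : ∀ {x y L} → Walk x y L → Walk y x (reverse L)
  reverseʷ ⟨ x ⟩ = ⟨ x ⟩
  reverseʷ (_∷_ {x} {L = L} e W) =
    subst (Walk _ _) (sym (unfold-reverse x L)) (reverseʷ W ++ʷ ⟨ x ⟩ via ~-sym e)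

  walk-nonempty : ∀ {x y L} → Walk x y L → 1 ≤ length L
  walk-nonempty ⟨ x ⟩   = s≤s z≤n
  walk-nonempty (_ ∷ _) = s≤s z≤n

  walk-linked : ∀ {x y z L} → Walk x y L → y ~ z → Linked _~_ (L ∷ʳ z)
  walk-linked ⟨ x ⟩           e = e ∷ [-]
  walk-linked (d ∷ ⟨ x ⟩)     e = d ∷ walk-linked ⟨ x ⟩ e
  walk-linked (d ∷ W@(_ ∷ _)) e = d ∷ walk-linked W e

  close : ∀ {x y L} → Walk x y L → Unique L → y ~ x → 3 ≤ length L →
          Σ[ C ∈ Cycle G ] cycleLength G C ≡ length L
  close W@(⟨ x ⟩) u e l = record
    { first = x ; rest = _ ; distinct = u ; edges = walk-linked W e ; long = l } , refl
  close W@(_∷_ {x} _ _) u e l = record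
    { first = x ; rest = _ ; distinct = u ; edges = walk-linked W e ; long = l } , refl

  record PathIn (P : Fin n → Set) (x y : Fin n) : Set where
    constructor path
    field
      {vertices} : List (Fin n)
      walk       : Walk x y vertices
      distinct   : Unique vertices
      all-in     : All P vertices

  module _ {P : Fin n → Set} where

    suffix : ∀ {x y z L} → Walk x y L → Unique L → All P L → z ∈ L → PathIn P z y
    suffix W@(⟨ x ⟩) u a (here refl) = path W u a
    suffix W@(_ ∷ _) u a (here refl) = path W u a
    suffix (_ ∷ W) (_ ∷ u) (_ ∷ a) (there z∈) = suffix W u a z∈

    -- Loop erasure: if `x` already lies on the path, the part of the path from `x` onwards is taken
    -- instead.
    consᵖ : ∀ {x y z} → P x → x ~ y → PathIn P y z → PathIn P x z
    consᵖ {x} px e (path {L} W u a) with DecMembership._∈?_ _≟_ x L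
    ... | yes x∈L = suffix W u a x∈L
    ... | no  x∉L = path (e ∷ W) (Allₚ.¬Any⇒All¬ L x∉L ∷ u) (px ∷ a)

    appendᵖ : ∀ {x y z L} → Walk x y L → All P L → PathIn P y z → PathIn P x z
    appendᵖ ⟨ x ⟩   _        Q = Q
    appendᵖ (e ∷ W) (px ∷ a) Q = consᵖ px e (appendᵖ W a Q)

    reverseᵖ : ∀ {x y} → PathIn P x y → PathIn P y x
    reverseᵖ (path {L} W u a) =
      path (reverseʷ W) (unique-reverse L u) (All.tabulate (All.lookup a ∘ Anyₚ.reverse⁻))

  -- Otherwise `x`, `u`, `y`, `w` would form a 4-cycle.
  common-neighbour-unique : (∀ C → 5 ≤ cycleLength G C) → ∀ {x y u w} → x ≢ y →
                            x ~ u → y ~ u → x ~ w → y ~ w → u ≡ w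
  common-neighbour-unique girth {x} {y} {u} {w} x≢y xu yu xw yw with u ≟ w
  ... | yes u≡w = u≡w
  ... | no  u≢w with C , eq ← close (xu ∷ ~-sym yu ∷ yw ∷ ⟨ w ⟩)
                  ((~⇒≢ xu ∷ x≢y ∷ ~⇒≢ xw ∷ []) ∷
                   (~⇒≢ (~-sym yu) ∷ u≢w ∷ []) ∷ (~⇒≢ yw ∷ []) ∷ [] ∷ [])
                  (~-sym xw) (s≤s (s≤s (s≤s z≤n)))
    = contradiction (subst (5 ≤_) eq (girth C)) λ { (s≤s (s≤s (s≤s (s≤s ())))) }

  -- Rooted forests inside the graph and their ancestor order.

  record Forest : Set where
    field
      parent        : Fin n → Maybe (Fin n)
      height        : Fin n → ℕ
      parent-height : ∀ {x p} → parent x ≡ just p → height x ≡ suc (height p)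
      parent-adj    : ∀ {x p} → parent x ≡ just p → x ~ p

  module Ancestry (F : Forest) where
    open Forest F public

    infix 4 _≼_ _≼?_

    data _≼_ (a : Fin n) : Fin n → Set where
      ≼-refl : a ≼ a
      ≼-step : ∀ {x p} → parent x ≡ just p → a ≼ p → a ≼ x

    parent-below : ∀ {x p} → parent x ≡ just p → height p < height x
    parent-below eq = ≤-reflexive (sym (parent-height eq))

    ≼-height : ∀ {a x} → a ≼ x → height a ≤ height x
    ≼-height ≼-refl        = ≤-refl
    ≼-height (≼-step eq p) = ≤-trans (≼-height p) (<⇒≤ (parent-below eq))

    ≼-trans : ∀ {a b c} → a ≼ b → b ≼ c → a ≼ c
    ≼-trans p ≼-refl        = p
    ≼-trans p (≼-step eq q) = ≼-step eq (≼-trans p q)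

    parent-≼ : ∀ {x p} → parent x ≡ just p → p ≼ x
    parent-≼ eq = ≼-step eq ≼-refl

    ≼-parent : ∀ {a x p} → a ≼ x → a ≢ x → parent x ≡ just p → a ≼ p
    ≼-parent ≼-refl        a≢x eq = contradiction refl a≢x
    ≼-parent (≼-step eq′ q) _   eq with refl ← trans (sym eq′) eq = q

    _≼?_ : ∀ a x → Dec (a ≼ x)
    a ≼? x = search (height x) x ≤-refl
      where
      search : ∀ m x → height x ≤ m → Dec (a ≼ x)
      search m x x≤m with a ≟ x
      ... | yes refl = yes ≼-refl
      ... | no a≢x with parent x in eq
      ... | nothing = no λ { ≼-refl → a≢x refl ; (≼-step eq′ _) → case trans (sym eq) eq′ of λ () }
      search zero x x≤m | no a≢x | just p = contradiction (<-≤-trans (parent-below eq) x≤m) n≮0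
      search (suc m) x x≤m | no a≢x | just p
        with search m p (s≤s⁻¹ (<-≤-trans (parent-below eq) x≤m))
      ... | yes a≼p = yes (≼-step eq a≼p)
      ... | no  a⋠p = no λ a≼x → a⋠p (≼-parent a≼x a≢x eq)

    chain : ∀ {a b x} → a ≼ x → b ≼ x → height a ≤ height b → a ≼ b
    chain a≼x ≼-refl _ = a≼x
    chain ≼-refl b≼x@(≼-step eq q) a≤b =
      contradiction (≤-<-trans (≼-height q) (parent-below eq)) (≤⇒≯ a≤b)
    chain (≼-step eq p) (≼-step eq′ q) a≤b with refl ← trans (sym eq) eq′ = chain p q a≤b

    ≼-antisym : ∀ {a b} → a ≼ b → height b ≤ height a → a ≡ b
    ≼-antisym ≼-refl _ = refl
    ≼-antisym (≼-step eq p) b≤a =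
      contradiction (≤-<-trans (≼-height p) (parent-below eq)) (≤⇒≯ b≤a)

    ≼-< : ∀ {a b} → a ≼ b → a ≢ b → height a < height b
    ≼-< a≼b a≢b = ≰⇒> λ b≤a → a≢b (≼-antisym a≼b b≤a)

    child-towards : ∀ {a x} → a ≼ x → height a < height x → ∃[ c ] parent c ≡ just a × c ≼ x
    child-towards ≼-refl a<x = contradiction a<x (<-irrefl refl)
    child-towards (≼-step eq ≼-refl) _ = _ , eq , ≼-refl
    child-towards (≼-step eq p@(≼-step eq′ q)) _ =
      map₂ (map₂ (≼-step eq)) (child-towards p (≤-<-trans (≼-height q) (parent-below eq′)))

    tree-walk : ∀ {a x} → a ≼ x → Σ[ L ∈ List (Fin n) ]
      Walk x a L × Unique L × All (λ z → a ≼ z × z ≼ x) L × length L + height a ≡ suc (height x)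
    tree-walk {a} ≼-refl = _ , ⟨ a ⟩ , [] ∷ [] , (≼-refl , ≼-refl) ∷ [] , refl
    tree-walk {x = x} (≼-step eq a≼p) with L , W , u , within , len ← tree-walk a≼p =
      x ∷ L , parent-adj eq ∷ W
      , All.map (λ { (_ , z≼p) refl →
          <-irrefl refl (≤-<-trans (≼-height z≼p) (parent-below eq)) }) within ∷ u
      , (≼-step eq a≼p , ≼-refl) ∷ All.map (map₂ (≼-step eq)) within
      , cong suc (trans len (sym (parent-height eq)))

    root-of : ∀ x → ∃[ r ] r ≼ x × parent r ≡ nothing
    root-of x = search (height x) x ≤-refl
      where
      search : ∀ m x → height x ≤ m → ∃[ r ] r ≼ x × parent r ≡ nothing
      search m x x≤m with parent x in eq
      ... | nothing = x , ≼-refl , eq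
      search zero x x≤m | just p = contradiction (<-≤-trans (parent-below eq) x≤m) n≮0
      search (suc m) x x≤m | just p
        with r , r≼p , root ← search m p (s≤s⁻¹ (<-≤-trans (parent-below eq) x≤m)) =
        r , ≼-step eq r≼p , root

    ancestors : ℕ → Fin n → List (Fin n)
    ancestors zero    x = []
    ancestors (suc m) x with parent x
    ... | nothing = x ∷ []
    ... | just p  = x ∷ ancestors m p

    ancestors-length : ∀ m x → length (ancestors m x) ≤ m
    ancestors-length zero    x = z≤n
    ancestors-length (suc m) x with parent x
    ... | nothing = s≤s z≤n
    ... | just p  = s≤s (ancestors-length m p)

    ∈-ancestors : ∀ m {a x} → a ≼ x → height x < height a + m → a ∈ ancestors m x
    ∈-ancestors zero {a} a≼x x<a =
      contradiction (≼-height a≼x) (<⇒≱ (<-≤-trans x<a (≤-reflexive (+-identityʳ (height a)))))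
    ∈-ancestors (suc m) {x = x} ≼-refl _ with parent x
    ... | nothing = here refl
    ... | just p  = here refl
    ∈-ancestors (suc m) {a} {x} (≼-step eq a≼p) x<a with parent x | eq
    ... | just p | refl = there (∈-ancestors m a≼p (s≤s⁻¹
      (subst₂ _<_ (parent-height eq) (+-suc (height a) m) x<a)))

-- Construction of a normal spanning forest with `v` as a root.

module NormalForest {n} (G : Graph n) (v : Fin n) where
  open Graph G
  open Walks G

  -- Giving the root v height n, rather than 0, keeps v a root while subtrees are re-hung.
  record RootedForest : Set where
    field
      forest       : Forest
      v-root       : Forest.parent forest v ≡ nothing
      v-height     : Forest.height forest v ≡ n
      other-height : ∀ {r} → Forest.parent forest r ≡ nothing → r ≢ v → Forest.height forest r ≡ 0
    open Ancestry forest public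

    Normal : Set
    Normal = ∀ {u w} → u ~ w → height w ≤ height u → w ≼ u

    -- The forest path from `x` to `r` has distinct vertices, hence at most `n` of them.
    below-root-height : ∀ {r x} → r ≼ x → height x < n + height r
    below-root-height {r} r≼x with L , _ , uniq , _ , len ← tree-walk r≼x =
      subst (_≤ n + height r) len (+-monoˡ-≤ (height r) (unique-length uniq))

    outside-v-height : ∀ {x} → ¬ v ≼ x → height x < n
    outside-v-height {x} v⋠x with r , r≼x , root ← root-of x =
      subst (height x <_) (trans (cong (n +_) (other-height root λ { refl → v⋠x r≼x })) (+-identityʳ n))
        (below-root-height r≼x)

    height-bound : ∀ x → height x ≤ n + n
    height-bound x with v ≼? x
    ... | yes v≼x = <⇒≤ (subst (λ m → height x < n + m) v-height (below-root-height v≼x))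
    ... | no  v⋠x = ≤-trans (<⇒≤ (outside-v-height v⋠x)) (m≤m+n n n)

  module Rehang (R : RootedForest) where
    open RootedForest R

    module _ {u w : Fin n} (u~w : u ~ w) (w≤u : height w ≤ height u) (w⋠u : ¬ w ≼ u) where

      -- Hanging `w` under `u` shifts every height in the subtree of `w` by this amount, which is
      -- positive because `height w ≤ height u`.
      gain : ℕ
      gain = suc (height u) ∸ height w

      parent′ : Fin n → Maybe (Fin n)
      parent′ x with x ≟ w
      ... | yes _ = just u
      ... | no  _ = parent x

      height′ : Fin n → ℕ
      height′ x with w ≼? x
      ... | yes _ = height x + gain
      ... | no  _ = height x

      height′-outside : ∀ {x} → ¬ w ≼ x → height′ x ≡ height x
      height′-outside {x} w⋠x with w ≼? x
      ... | yes w≼x = contradiction w≼x w⋠x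
      ... | no  _   = refl

      height′-w : height′ w ≡ suc (height u)
      height′-w with w ≼? w
      ... | yes _  = m+[n∸m]≡n (m≤n⇒m≤1+n w≤u)
      ... | no  w⋠w = contradiction ≼-refl w⋠w

      height′-≥ : ∀ x → height x ≤ height′ x
      height′-≥ x with w ≼? x
      ... | yes _ = m≤m+n (height x) gain
      ... | no  _ = ≤-refl

      parent′-height′ : ∀ {x p} → parent′ x ≡ just p → height′ x ≡ suc (height′ p)
      parent′-height′ {x} {p} eq with x ≟ w
      parent′-height′ refl | yes refl = trans height′-w (cong suc (sym (height′-outside w⋠u)))
      parent′-height′ {x} {p} eq | no x≢w with w ≼? x | w ≼? p
      -- For `x ≢ w`, the subtree of `w` contains `x` exactly when it contains `p`, so either both
      -- heights shift or neither does.
      ... | yes _   | yes _   = cong (_+ gain) (parent-height eq)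
      ... | yes w≼x | no  w⋠p = contradiction (≼-parent w≼x (x≢w ∘ sym) eq) w⋠p
      ... | no  w⋠x | yes w≼p = contradiction (≼-step eq w≼p) w⋠x
      ... | no  _   | no  _   = parent-height eq

      parent′-adj : ∀ {x p} → parent′ x ≡ just p → x ~ p
      parent′-adj {x} eq with x ≟ w
      parent′-adj refl | yes refl = ~-sym u~w
      ... | no _ = parent-adj eq

      forest′ : Forest
      forest′ = record
        { parent = parent′ ; height = height′
        ; parent-height = parent′-height′ ; parent-adj = parent′-adj }

      -- If `w` were `v`, then `u` would lie in another tree, where all heights are less than `n`,
      -- the height of `v`.
      w≢v : w ≢ v
      w≢v refl = <⇒≱ (outside-v-height w⋠u) (subst (_≤ height u) v-height w≤u)

      parent′-root : ∀ {x} → parent′ x ≡ nothing → parent x ≡ nothing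
      parent′-root {x} eq with x ≟ w
      ... | no _ = eq

      root-unmoved : ∀ {x} → x ≢ w → parent x ≡ nothing → height′ x ≡ height x
      root-unmoved x≢w eq = height′-outside λ where
        ≼-refl         → x≢w refl
        (≼-step eq′ _) → case trans (sym eq) eq′ of λ ()

      v-root′ : parent′ v ≡ nothing
      v-root′ with v ≟ w
      ... | yes v≡w = contradiction (sym v≡w) w≢v
      ... | no  _   = v-root

      rehang : RootedForest
      rehang = record
        { forest       = forest′
        ; v-root       = v-root′
        ; v-height     = trans (root-unmoved (w≢v ∘ sym) v-root) v-height
        ; other-height = λ {r} eq r≢v →
            trans (root-unmoved (λ { refl → not-root eq }) (parent′-root eq))
                  (other-height (parent′-root eq) r≢v)
        }
        where
        not-root : parent′ w ≢ nothing
        not-root eq with w ≟ w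
        not-root () | yes _
        ... | no w≢w = w≢w refl

      rehang-gains : ∑ height < ∑ height′
      rehang-gains = ∑-mono-< height′-≥ w (subst (height w <_) (sym height′-w) (s≤s w≤u))

  trivial : RootedForest
  trivial = record
    { forest = record
        { parent = λ _ → nothing ; height = root-height
        ; parent-height = λ () ; parent-adj = λ () }
    ; v-root = refl
    ; v-height = at-v
    ; other-height = λ _ → elsewhere
    }
    where
    root-height : Fin n → ℕ
    root-height x with x ≟ v
    ... | yes _ = n
    ... | no  _ = 0

    at-v : root-height v ≡ n
    at-v with v ≟ v
    ... | yes _  = refl
    ... | no v≢v = contradiction refl v≢v

    elsewhere : ∀ {r} → r ≢ v → root-height r ≡ 0
    elsewhere {r} r≢v with r ≟ v
    ... | yes r≡v = contradiction r≡v r≢v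
    ... | no  _   = refl

  -- Re-hanging raises the total height, which is bounded; a forest that cannot be re-hung is normal.
  normal-forest : Σ[ R ∈ RootedForest ] RootedForest.Normal R
  normal-forest = improve (n * (n + n)) trivial (m≤n+m _ _)
    where
    improve : ∀ m (R : RootedForest) → n * (n + n) ≤ ∑ (RootedForest.height R) + m →
              Σ[ R ∈ RootedForest ] RootedForest.Normal R
    improve m R bound
      with any? (λ u → any? λ w → (u ~? w) ×-dec ((height w ≤? height u) ×-dec ¬? (w ≼? u)))
      where open RootedForest R
    ... | no  none = R , λ u~w w≤u → decidable-stable (RootedForest._≼?_ R _ _)
                           λ w⋠u → none (_ , _ , u~w , w≤u , w⋠u)
    improve zero R bound | yes (u , w , u~w , w≤u , w⋠u) =
      contradiction (≤-trans bound (≤-reflexive (+-identityʳ _)))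
        (<⇒≱ (<-≤-trans (Rehang.rehang-gains R u~w w≤u w⋠u)
          (∑-bound (RootedForest.height-bound (Rehang.rehang R u~w w≤u w⋠u)))))
    improve (suc m) R bound | yes (u , w , u~w , w≤u , w⋠u) =
      improve m (Rehang.rehang R u~w w≤u w⋠u)
        (≤-trans bound (≤-trans (≤-reflexive (+-suc _ m))
          (+-monoˡ-≤ m (Rehang.rehang-gains R u~w w≤u w⋠u))))

-- The colouring by highest neighbours.

opposite-≢ : (c : Fin 2) → opposite c ≢ c
opposite-≢ zero       ()
opposite-≢ (suc zero) ()

module Colour {n} (G : Graph n) (F : Walks.Forest G) where
  open Graph G
  open Walks G
  open Ancestry F

  Up : Fin n → Fin n → Set
  Up u y = y ~ u × height y < height u

  up? : ∀ u y → Dec (Up u y)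
  up? u y = (y ~? u) ×-dec (height y <? height u)

  highest? : ∀ u → Dec (∃ (Minimal (up? u) height))
  highest? u = map′ (minimal (up? u) height) (map₂ proj₁) (any? (up? u))

  -- The number is fuel. The recursion passes to a neighbour of smaller height, so any fuel greater
  -- than `height u` gives the same colour.
  colour-within : ℕ → Fin n → Fin 2
  colour-within zero    u = zero
  colour-within (suc m) u with highest? u
  ... | yes (x , _) = opposite (colour-within m x)
  ... | no  _       = zero

  colour-within-stable : ∀ {m m′} u → height u < m → height u < m′ →
                         colour-within m u ≡ colour-within m′ u
  colour-within-stable {suc m} {suc m′} u (s≤s u≤m) (s≤s u≤m′) with highest? u
  ... | yes (x , (_ , x<u) , _) =
    cong opposite (colour-within-stable x (<-≤-trans x<u u≤m) (<-≤-trans x<u u≤m′))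
  ... | no  _ = refl

  colour : Fin n → Fin 2
  colour u = colour-within (suc (height u)) u

  colour-highest : ∀ {u y} → y ~ u → height y < height u →
                   ∃[ x ] Minimal (up? u) height x × colour u ≢ colour x
  colour-highest {u} {y} y~u y<u with highest? u
  ... | no none = contradiction (minimal (up? u) height (y , y~u , y<u)) none
  ... | yes (x , min@((_ , x<u) , _)) = x , min ,
    -- `colour u` unfolds to `opposite (colour-within (height u) x)`; the fuel there can be replaced
    -- by that of `colour x`.
    subst (λ c → opposite c ≢ colour x) (colour-within-stable x ≤-refl x<u) (opposite-≢ (colour x))

-- Neighbours of equal colour in a normal forest.

module Normal {n} (G : Graph n) (F : Walks.Forest G)
              (normal : ∀ {u w} → Graph._~_ G u w →
                        Walks.Forest.height F w ≤ Walks.Forest.height F u → Walks.Ancestry._≼_ G F w u) where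
  open Graph G
  open Walks G
  open Ancestry F
  open Colour G F

  -- The highest neighbour `x` of `u` differs from `u` in colour, so `x ≢ y`. Both are ancestors of
  -- `u`, hence comparable, and `x` is not below `y`.
  same-colour⇒higher : ∀ {u y} → u ~ y → height y < height u → colour u ≡ colour y →
                       ∃[ x ] x ~ u × height x < height y
  same-colour⇒higher u~y y<u same with x , ((x~u , x<u) , low) , fu≢fx ← colour-highest (~-sym u~y) y<u =
    x , x~u , ≼-< (chain x≼u y≼u x≤y) λ { refl → fu≢fx same }
    where
    x≤y = low (~-sym u~y , y<u)
    x≼u = normal (~-sym x~u) (<⇒≤ x<u)
    y≼u = normal u~y (<⇒≤ y<u)

  -- A neighbour with the colour of the root would lie below it and so have another neighbour
  -- strictly above the root.
  root-properlyColoured : ∀ {v} → parent v ≡ nothing → ProperlyColoured G colour v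
  root-properlyColoured {v} root w v~w same = case normal (~-sym v~w) v≤w of below
    where
    root-below : ∀ {x} → x ≼ v → x ≡ v
    root-below ≼-refl        = refl
    root-below (≼-step eq _) = case trans (sym root) eq of λ ()

    v≤w : height v ≤ height w
    v≤w = ≮⇒≥ λ w<v → ~⇒≢ v~w (sym (root-below (normal v~w (<⇒≤ w<v))))

    below : v ≼ w → ⊥
    below v≼w with x , x~w , x<v ← same-colour⇒higher (~-sym v~w) (≼-< v≼w (~⇒≢ v~w)) (sym same)
      with refl ← root-below (chain (normal (~-sym x~w) (≤-trans (<⇒≤ x<v) v≤w)) v≼w (<⇒≤ x<v))
      = <-irrefl refl x<v

  -- Depth of a monochromatic connected set `S` with top vertex `t`.

  module Component
    {k : ℕ} (1≤k : 1 ≤ k) (circumference : ∀ C → cycleLength G C ≤ k)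
    (girth : ∀ C → 5 ≤ cycleLength G C)
    (S : Subset n) (connected : ∀ {u w} → u Subset.∈ S → w Subset.∈ S → Star (InducedAdj G S) u w)
    (monochromatic : ∀ {u w} → u Subset.∈ S → w Subset.∈ S → colour u ≡ colour w)
    {t : Fin n} (t∈S : t Subset.∈ S) (t-lowest : ∀ {w} → w Subset.∈ S → height t ≤ height w)
    where

    -- A walk in `S` from `t` stays in the subtree of `t`: its edges join comparable vertices, and
    -- an upward step cannot pass `t`, whose height is least in `S`.
    t≼ : ∀ {w} → w Subset.∈ S → t ≼ w
    t≼ w∈S = along (connected t∈S w∈S) ≼-refl
      where
      along : ∀ {a b} → Star (InducedAdj G S) a b → t ≼ a → t ≼ b
      along ε t≼a = t≼a
      along {a} (_◅_ {j = b} (_ , b∈S , a~b) rest) t≼a =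
        along rest $ case ≤-total (height a) (height b) of λ where
        (inj₁ a≤b) → ≼-trans t≼a (normal (~-sym a~b) a≤b)
        (inj₂ b≤a) → chain t≼a (normal a~b b≤a) (t-lowest b∈S)

    -- The forest path from `p` up to `a` is disjoint from `W`, which lies in the subtree of the
    -- child `q` of `p`. Together they form a cycle, of length at most `k`; the path contributes
    -- `height p - height a + 1` vertices.
    close-bound : ∀ {q p a x y L} → parent q ≡ just p → Walk y x L → Unique L → All (q ≼_) L →
                  x ~ p → y ~ a → a ≼ p → height a < height p →
                  length L + suc (height p) ≤ height a + k
    close-bound {q} {p} {a} {x} {y} {L} eq W u below x~p y~a a≼p a<p
      with M , V , u′ , above , len ← tree-walk a≼p
      with C , len-C ← close (V ++ʷ W via ~-sym y~a)
             (Uniqueₚ.++⁺ u′ u λ { (z∈M , z∈L) → <-irrefl refl (≤-<-trans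
               (≤-trans (≼-height (All.lookup below z∈L)) (≼-height (proj₂ (All.lookup above z∈M))))
               (parent-below eq)) })
             x~p
             (subst (3 ≤_) (sym (length-++ M)) (+-mono-≤
               (+-cancelʳ-≤ (height a) 2 (length M) (≤-trans (s≤s a<p) (≤-reflexive (sym len))))
               (walk-nonempty W)))
      = begin
        length L + suc (height p)         ≡⟨ cong (length L +_) (sym len) ⟩
        length L + (length M + height a)  ≡⟨ +-assoc (length L) (length M) (height a) ⟨
        length L + length M + height a    ≡⟨ cong (_+ height a) (+-comm (length L) (length M)) ⟩
        length M + length L + height a    ≡⟨ cong (_+ height a) (length-++ M) ⟨
        length (M ++ L) + height a        ≤⟨ +-monoˡ-≤ (height a) (subst (_≤ k) len-C (circumference C)) ⟩
        k + height a                      ≡⟨ +-comm k (height a) ⟩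
        height a + k                      ∎
      where open ≤-Reasoning

    -- The higher neighbour `x` will force the low point of `q` strictly above `p`; the pair of `x`
    -- and `y` will identify `q` among the children of `p`.
    Escape : Fin n → Fin n → Set
    Escape q p = ∃[ u ] ∃[ x ] ∃[ y ] q ≼ u × x ~ u × y ~ u × x ≼ p × y ≼ p × height x < height y

    -- The walk in `S` from `w` to `t` must leave the subtree of `q`. By normality it leaves to an
    -- ancestor `y` of `p`, and `same-colour⇒higher` for that edge gives `x`.
    escape : ∀ {q p w} → parent q ≡ just p → t ≼ p → w Subset.∈ S → q ≼ w →
             Escape q p
    escape {q} {p} eq t≼p w∈S q≼w = exit (connected w∈S t∈S) q≼w
        (λ q≼t → <⇒≱ (parent-below eq) (≤-trans (≼-height q≼t) (≼-height t≼p)))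
      where
      exit : ∀ {a b} → Star (InducedAdj G S) a b → q ≼ a → ¬ q ≼ b →
             Escape q p
      exit ε q≼a q⋠a = contradiction q≼a q⋠a
      exit {a} (_◅_ {j = y} (a∈S , y∈S , a~y) rest) q≼a q⋠b with q ≼? y
      ... | yes q≼y = exit rest q≼y q⋠b
      ... | no  q⋠y = leave
        where
        y<a : height y < height a
        y<a = ≰⇒> λ a≤y → q⋠y (≼-trans q≼a (normal (~-sym a~y) a≤y))

        y≼a : y ≼ a
        y≼a = normal a~y (<⇒≤ y<a)

        y≼p : y ≼ p
        y≼p = ≼-parent (chain y≼a q≼a (≰⇒≥ λ q≤y → q⋠y (chain q≼a y≼a q≤y))) (λ { refl → q⋠y ≼-refl }) eq

        leave : Escape q p
        leave with x , x~a , x<y ← same-colour⇒higher a~y y<a (monochromatic a∈S y∈S) =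
          a , x , y , q≼a , x~a , ~-sym a~y ,
          ≼-trans (chain (normal (~-sym x~a) (<⇒≤ (<-trans x<y y<a))) y≼a (<⇒≤ x<y)) y≼p , y≼p , x<y

    Touches : Fin n → Fin n → Set
    Touches q a = ∃[ u ] q ≼ u × u ~ a

    touches? : ∀ q a → Dec (Touches q a)
    touches? q a = any? λ u → (q ≼? u) ×-dec (u ~? a)

    -- This is the lowpoint of depth-first search. The vertex `x` from `escape` also touches the
    -- subtree of `q` and is strictly above `p`, so the minimiser `a` is too.
    low-point : ∀ {q p w} → parent q ≡ just p → t ≼ p → w Subset.∈ S → q ≼ w →
                ∃[ a ] Minimal (touches? q) height a × a ≼ p × height a < height p
    low-point {q} {p} eq t≼p w∈S q≼w
      with u , x , y , q≼u , x~u , _ , x≼p , y≼p , x<y ← escape eq t≼p w∈S q≼w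
      with a , min@((u′ , q≼u′ , u′~a) , low) ← minimal (touches? q) height (x , u , q≼u , ~-sym x~u)
      = a , min , chain (normal u′~a (<⇒≤ (<-≤-trans a<p (≼-height p≼u′)))) p≼u′ (<⇒≤ a<p) , a<p
      where
      p≼u′ = ≼-trans (parent-≼ eq) q≼u′
      a<p  = ≤-<-trans (low (u , q≼u , ~-sym x~u)) (<-≤-trans x<y (≼-height y≼p))

    -- Go up the forest from `u` to `q′`, then down to `p`, and erase loops. Neither part meets the
    -- subtree of `q`: the first lies above `u`, which is outside it, and the second lies above `p`.
    detour : ∀ {q q′ p u} → parent q ≡ just p → q′ ≼ p → q′ ≼ u → ¬ q ≼ u →
             PathIn (λ z → q′ ≼ z × ¬ q ≼ z) u p
    detour eq q′≼p q′≼u q⋠u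
      with _ , W , _ , down , _ ← tree-walk q′≼u
      with _ , V , uniq , up , _ ← tree-walk q′≼p
      = appendᵖ W (All.map (λ (q′≼z , z≼u) → q′≼z , λ q≼z → q⋠u (≼-trans q≼z z≼u)) down)
          (reverseᵖ (path V uniq (All.map (λ (q′≼z , z≼p) → q′≼z ,
            λ q≼z → <⇒≱ (parent-below eq) (≤-trans (≼-height q≼z) (≼-height z≼p))) up)))

    -- A simple walk L inside the subtree of q, with ends adjacent to the parent p of q and to
    -- the low point a of q, closes to a cycle through the forest path between a and p.  Let q′
    -- be the child of a above q, with low point a′.  By minimality of a, the edge from the
    -- subtree of q′ to a′ starts outside the subtree of q; so L, extended from its end at p by
    -- a path avoiding that subtree, is such a walk for q′, and it is longer.
    climb : ∀ m {q p a x y w L} → w Subset.∈ S → q ≼ w → parent q ≡ just p → t ≼ p →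
            (∀ {b} → Touches q b → height a ≤ height b) → a ≼ p → height a < height p →
            Walk y x L → Unique L → All (q ≼_) L → x ~ p → y ~ a →
            k ≤ length L + m → suc (height p) < height t + suc m * k
    climb m {q} {p} {a} {x} {y} {w} {L} w∈S q≼w eq t≼p low a≼p a<p W uniq below x~p y~a k≤ = go m k≤
      where
      open ≤-Reasoning

      closed : length L + suc (height p) ≤ height a + k
      closed = close-bound eq W uniq below x~p y~a a≼p a<p

      closed₁ : suc (suc (height p)) ≤ height a + k
      closed₁ = ≤-trans (+-monoˡ-≤ (suc (height p)) (walk-nonempty W)) closed

      -- Each round lengthens `L`, so `m` bounds the number of rounds left. A round climbs fewer
      -- than `k` levels by `closed₁`, and the climb ends once `a` is above `t`.
      go : ∀ m → k ≤ length L + m → suc (height p) < height t + suc m * k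
      go m k≤ with height a <? height t
      ... | yes a<t = begin
        suc (suc (height p))    ≤⟨ closed₁ ⟩
        height a + k            ≤⟨ +-mono-≤ (<⇒≤ a<t) (m≤m+n k (m * k)) ⟩
        height t + suc m * k    ∎
      -- Here `L` alone has at least `k` vertices, so the closed cycle would be longer than `k`.
      go zero k≤ | no _ = contradiction (+-cancelʳ-≤ k _ _ (begin
        suc (height p) + k         ≡⟨ +-comm (suc (height p)) k ⟩
        k + suc (height p)         ≤⟨ +-monoˡ-≤ (suc (height p)) (subst (k ≤_) (+-identityʳ _) k≤) ⟩
        length L + suc (height p)  ≤⟨ closed ⟩
        height a + k               ∎)) (<⇒≱ (m<n⇒m<1+n a<p))
      go (suc m) k≤ | no a≮t
        with q′ , eq′ , q′≼p ← child-towards a≼p a<p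
        with a′ , ((u , q′≼u , u~a′) , low′) , a′≼a , a′<a ←
             low-point eq′ (chain t≼p a≼p (≮⇒≥ a≮t)) w∈S (≼-trans q′≼p (≼-trans (parent-≼ eq) q≼w))
        with path {M} V uniq′ within ← detour eq q′≼p q′≼u (λ q≼u → <⇒≱ a′<a (low (u , q≼u , u~a′)))
        = begin
          suc (suc (height p))          ≤⟨ closed₁ ⟩
          height a + k                  ≤⟨ +-monoˡ-≤ k (≤-trans (n≤1+n _) (<⇒≤ higher)) ⟩
          height t + suc m * k + k      ≡⟨ +-assoc (height t) (suc m * k) k ⟩
          height t + (suc m * k + k)    ≡⟨ cong (height t +_) (+-comm (suc m * k) k) ⟩
          height t + suc (suc m) * k    ∎
        where
        L′ = M ++ reverse L

        higher : suc (height a) < height t + suc m * k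
        higher = climb m w∈S (≼-trans q′≼p (≼-trans (parent-≼ eq) q≼w)) eq′
          (chain t≼p a≼p (≮⇒≥ a≮t)) low′ a′≼a a′<a
          -- Reversed, `L` starts next to `p`, where `V` ends, and finishes at `y`, which is
          -- adjacent to the parent `a` of `q′`.
          (V ++ʷ reverseʷ W via ~-sym x~p)
          (Uniqueₚ.++⁺ uniq′ (unique-reverse L uniq) λ { (z∈M , z∈L) →
            proj₂ (All.lookup within z∈M) (All.lookup below (Anyₚ.reverse⁻ z∈L)) })
          (Allₚ.++⁺ (All.map proj₁ within) (All.tabulate λ z∈L →
            ≼-trans q′≼p (≼-trans (parent-≼ eq) (All.lookup below (Anyₚ.reverse⁻ z∈L)))))
          y~a u~a′
          (begin
            k                                  ≤⟨ k≤ ⟩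
            length L + suc m                   ≡⟨ +-suc (length L) m ⟩
            suc (length L) + m                 ≤⟨ +-monoˡ-≤ m (+-monoˡ-≤ (length L) (walk-nonempty V)) ⟩
            length M + length L + m            ≡⟨ cong (λ l → length M + l + m) (length-reverse L) ⟨
            length M + length (reverse L) + m  ≡⟨ cong (_+ m) (length-++ M) ⟨
            length L′ + m                      ∎)

    shallow : ∀ {w} → w Subset.∈ S → height w < height t + k * k
    shallow {w} w∈S with t≼ w∈S
    ... | ≼-refl = m<m+n (height t) (*-mono-≤ 1≤k 1≤k)
    ... | ≼-step {p = p} eq t≼p
      with a , ((u , w≼u , u~a) , low) , a≼p , a<p ← low-point eq t≼p w∈S ≼-refl
      with L , W , uniq , within , _ ← tree-walk w≼u
      -- The initial walk is the forest path between `u` and `w`. It has at least one vertex, so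
      -- `k ∸ 1` rounds suffice, and `suc (k ∸ 1) * k` is `k * k`.
      = subst₂ (λ h m → h < height t + m * k) (sym (parent-height eq)) (m+[n∸m]≡n 1≤k)
          (climb (k ∸ 1) w∈S ≼-refl eq t≼p low a≼p a<p W uniq (All.map proj₁ within) (parent-adj eq) u~a
            (≤-trans (≤-reflexive (sym (m+[n∸m]≡n 1≤k))) (+-monoˡ-≤ (k ∸ 1) (walk-nonempty W))))

    -- Bounded branching and the size of `S`.

    Fork : Fin n → Fin n × Fin n → Fin n → Fin n → Set
    Fork z (x , y) u c = x ≢ y × x ~ u × y ~ u × parent c ≡ just z × c ≼ u

    fork? : ∀ z xy → Dec (∃[ u ] ∃[ c ] Fork z xy u c)
    fork? z (x , y) = any? λ u → any? λ c →
      ¬? (x ≟ y) ×-dec (x ~? u) ×-dec (y ~? u) ×-dec maybe-≡-dec _≟_ (parent c) (just z) ×-dec (c ≼? u)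

    -- The vertices `x` and `y` have only one common neighbour, and that vertex has at most one
    -- ancestor at the height of the children of `z`.
    fork-unique : ∀ {z xy u c u′ c′} → Fork z xy u c → Fork z xy u′ c′ → c ≡ c′
    fork-unique (x≢y , x~u , y~u , eq , c≼u) (_ , x~u′ , y~u′ , eq′ , c′≼u′)
      with refl ← common-neighbour-unique girth x≢y x~u y~u x~u′ y~u′ =
      ≼-antisym (chain c≼u c′≼u′ (≤-reflexive same)) (≤-reflexive (sym same))
      where same = trans (parent-height eq) (sym (parent-height eq′))

    -- The forest path from `u` to `c` closes to a cycle through `z` and `x`. So `x`, and with it
    -- the lower `y`, is among the `k` nearest ancestors of `z`, counting `z` itself.
    escape-fork : ∀ {c z w} → parent c ≡ just z → t ≼ z → w Subset.∈ S → c ≼ w →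
                  ∃[ xy ] xy ∈ cartesianProduct (ancestors k z) (ancestors k z) × ∃[ u ] Fork z xy u c
    escape-fork {c} {z} eq t≼z w∈S c≼w
      with u , x , y , c≼u , x~u , y~u , x≼z , y≼z , x<y ← escape eq t≼z w∈S c≼w
      with L , W , uniq , within , _ ← tree-walk c≼u
      = (x , y)
      , ∈-cartesianProduct⁺ (∈-ancestors k x≼z near)
          (∈-ancestors k y≼z (<-≤-trans near (+-monoˡ-≤ k (<⇒≤ x<y))))
      , u , (λ { refl → <-irrefl refl x<y }) , x~u , y~u , eq , c≼u
      where
      near : height z < height x + k
      near = ≤-trans (m≤n+m _ (length L)) (close-bound eq W uniq (All.map proj₁ within)
        (parent-adj eq) (~-sym x~u) x≼z (<-≤-trans x<y (≼-height y≼z)))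

    -- Induction on the remaining depth `d`. Each of the at most `k * k` pairs in `K` accounts for
    -- at most one child of `z`, and these children cover all of `S` strictly below `z`.
    cover : ∀ d z → t ≼ z → (∀ {w} → w Subset.∈ S → z ≼ w → height w < height z + d) →
            Covered (λ w → w Subset.∈ S × z ≼ w) (suc (k * k) ^ d)
    cover zero z t≼z near = [] , z≤n , λ (w∈S , z≼w) →
      contradiction (≼-height z≼w) (<⇒≱ (<-≤-trans (near w∈S z≼w) (≤-reflexive (+-identityʳ _))))
    cover (suc d) z t≼z near = collect (covered-⋃ branch K)
      where
      open ≤-Reasoning
      A = ancestors k z
      K = cartesianProduct A A
      N = suc (k * k) ^ d

      Branch : Fin n × Fin n → Fin n → Set
      Branch xy w = w Subset.∈ S × ∃[ u ] ∃[ c ] Fork z xy u c × c ≼ w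

      branch : ∀ xy → Covered (Branch xy) N
      branch xy with fork? z xy
      ... | no none = [] , z≤n , λ (_ , u , c , fork , _) → contradiction (u , c , fork) none
      ... | yes (u , c , fork@(_ , _ , _ , eq , _))
        with L , L≤ , covers ← cover d c (≼-trans t≼z (parent-≼ eq))
               (λ {w} w∈S c≼w → subst (height w <_)
                 (trans (+-suc (height z) d) (cong (_+ d) (sym (parent-height eq))))
                 (near w∈S (≼-trans (parent-≼ eq) c≼w)))
        = L , L≤ , λ (w∈S , _ , _ , fork′ , c′≼w) →
            covers (w∈S , subst (_≼ _) (fork-unique fork′ fork) c′≼w)

      |K|≤ : length K ≤ k * k
      |K|≤ = subst (_≤ k * k) (sym (length-cartesianProduct A A))
        (*-mono-≤ (ancestors-length k z) (ancestors-length k z))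

      collect : Covered (λ w → ∃[ xy ] xy ∈ K × Branch xy w) (length K * N) →
                Covered (λ w → w Subset.∈ S × z ≼ w) (suc (k * k) ^ suc d)
      collect (L , L≤ , covers) = z ∷ L
        -- The vertex `z` itself is paid for by `1 ≤ N`, which is why the base is `suc (k * k)`.
        , +-mono-≤ (m^n>0 (suc (k * k)) d) (≤-trans L≤ (*-monoˡ-≤ N |K|≤))
        , λ {w} (w∈S , z≼w) → split w∈S z≼w
        where
        split : ∀ {w} → w Subset.∈ S → z ≼ w → w ∈ z ∷ L
        split {w} w∈S z≼w with z ≟ w
        ... | yes refl = here refl
        ... | no z≢w
          with c , eq , c≼w ← child-towards z≼w (≼-< z≼w z≢w)
          with xy , xy∈K , u , fork ← escape-fork eq t≼z w∈S c≼w
          = there (covers (xy , xy∈K , w∈S , u , c , fork , c≼w))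

    component-size : ∣ S ∣ ≤ suc (k * k) ^ (k * k)
    component-size with L , L≤ , covers ← cover (k * k) t ≼-refl (λ w∈S _ → shallow w∈S) =
      covered-size (L , L≤ , λ w∈S → covers (w∈S , t≼ w∈S))

-- From the forest argument to the definitions of the theorem.

∈-colourClass⁻ : ∀ {n q} (G : Graph n) (f : Colouring G q) {i w} → w Subset.∈ colourClass G f i → f w ≡ i
∈-colourClass⁻ G f {i} {w} w∈ with f w ≟ i in eq
... | yes fw≡i = fw≡i
... | no  _    = case trans (sym ([]=⇒lookup w∈)) (trans (lookup∘tabulate _ w) (cong isYes eq)) of λ ()

circumference-bound : ∀ {n} {G : Graph n} {k} → IsCircumference G k →
                      1 ≤ k × (∀ C → cycleLength G C ≤ k)
circumference-bound (inj₁ (forest , refl))     = s≤s z≤n , λ C → contradiction C forest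
circumference-bound (inj₂ ((C , refl) , most)) = s≤s z≤n , most

girth-bound : ∀ {n} {G : Graph n} {g} → IsGirth G g → [ 5 ] ≤⁺ g → ∀ C → 5 ≤ cycleLength G C
girth-bound {g = ⊤⁺}    forest         _   C = contradiction C forest
girth-bound {g = [ _ ]} (_ , shortest) 5≤g C = ≤-trans ([≤]-injective _≤_ 5≤g) (shortest C)

clustering-arith : ∀ {k} → 1 ≤ k → suc (k * k) ^ (k * k) ≤ (4 * k ^ 2) ^ (k ^ 2)
-- The bases compare because `1 ≤ k * k`, so `1 + k * k` is at most two of the four copies of
-- `k * k`.
clustering-arith {k} 1≤k rewrite *-identityʳ k = ^-monoˡ-≤ (k * k)
  (+-mono-≤ (*-mono-≤ 1≤k 1≤k) (m≤m+n (k * k) _))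

theorem19 : ∀ {n : ℕ} (G : Graph n) (k : ℕ) (g : ℕ ⁺) →
    IsCircumference G k → IsGirth G g → [ 5 ] ≤⁺ g →
    ∀ (v : Fin n) →
    Σ[ f ∈ Colouring G 2 ]
    (HasClustering G f ((4 * k ^ 2) ^ (k ^ 2)) × ProperlyColoured G f v)
theorem19 G k g circ girth 5≤g v = colour , clustered , root-properlyColoured v-root
  where
  normalForest = NormalForest.normal-forest G v
  open NormalForest.RootedForest (proj₁ normalForest)
  open Colour G forest
  open Normal G forest (proj₂ normalForest)

  clustered : HasClustering G colour ((4 * k ^ 2) ^ (k ^ 2))
  clustered i S (S⊆ , (nonempty , connected) , _)
    with 1≤k , bound ← circumference-bound circ
    with t , t∈S , lowest ← minimal (_∈? S) height nonempty
    = ≤-trans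
        (Component.component-size 1≤k bound (girth-bound girth 5≤g) S connected
          (λ u∈S w∈S → trans (∈-colourClass⁻ G colour (S⊆ u∈S)) (sym (∈-colourClass⁻ G colour (S⊆ w∈S))))
          t∈S lowest)
        (clustering-arith 1≤k)
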